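{- Let $\mathcal{P}$ be a reliable graph property with $d(\mathcal{P})=r$, let $G$ be a graph, and let $(X,H)$ be a $\mathcal{P}$-critical cover of $G$. Then the following statements hold: (a) $d_G(v)\ge r|X_v|$ for all $v\in V(G)$. (b) Let $v$ be a vertex of $G$ such that $d_G(v)=r|X_v|$, and let $T$ be a $(\mathcal{P},v)$-transversal of $(X,H)$. Moreover, for $x\in X_v$, let $H_x=H[T\cup\{x\}]$ and $d_x=d_{H_x}(x)$. Then $d_x=r$ for all $x\in X_v$ and $d_G(v)=\sum_{x\in X_v}d_x$.
   Context: Graphs are finite, undirected, may have multiple edges, no loops. $\mu_G(u,v)$ is the number of edges joining $u$ and $v$; $d_G(v)$ is the number of edges incident with $v$; $\delta(G)$ is the minimum degree. A cover of $G$ is a pair $(X,H)$ where $H$ is a graph and $X$ assigns to each $v\in V(G)$ a set $X_v\subseteq V(H)$ such that the sets $X_v$ are pairwise disjoint, $V(H)=\bigcup_v X_v$, each $X_v$ is independent in $H$, and for distinct $u,v\in V(G)$ the set $E_H(X_u,X_v)$ of edges of $H$ between $X_u$ and $X_v$ is the union of $\mu_G(u,v)$ (possibly empty) matchings of $H$. A transversal of $(X,H)$ is a set $T\subseteq V(H)$ with $|T\cap X_v|=1$ for all $v\in V(G)$; a partial transversal satisfies $|T\cap X_v|\le 1$ for all $v$; $\mathrm{dom}(T:G)=\{v\in V(G): X_v\cap T\neq\varnothing\}$. A graph property is a class of graphs closed under isomorphism. It is non-trivial if it contains a non-empty graph but not all graphs; hereditary if closed under induced subgraphs; additive if closed under disjoint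 unions; reliable if non-trivial, hereditary and additive. For non-trivial hereditary $\mathcal{P}$: $\mathrm{CR}(\mathcal{P})$ is the class of graphs $G\notin\mathcal{P}$ with $G-v\in\mathcal{P}$ for all $v\in V(G)$, and $d(\mathcal{P})=\min\{\delta(G): G\in\mathrm{CR}(\mathcal{P})\}$. A $\mathcal{P}$-transversal of $(X,H)$ is a transversal $T$ with $H[T]\in\mathcal{P}$. A $(\mathcal{P},v)$-transversal of $(X,H)$ is a partial transversal $T$ with $\mathrm{dom}(T:G)=V(G)\setminus\{v\}$ and $H[T]\in\mathcal{P}$. The cover $(X,H)$ of $G$ is $\mathcal{P}$-critical if it has no $\mathcal{P}$-transversal, but for every $v\in V(G)$ it has a $(\mathcal{P},v)$-transversal. -}

module Defs where

open import Level using (Level; 0ℓ) renaming (suc to lsuc)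
open import Data.Nat using (ℕ; zero; suc; _+_; _≤_; _>_)
open import Data.Nat.Properties using (+-0-commutativeMonoid)
open import Data.Fin using (Fin; zero; suc; splitAt)
open import Data.Fin.Subset
  using (Subset; inside; outside; ⊤; ⁅_⁆; _∈_; _∩_; _∪_; _-_; ∣_∣; Nonempty; Empty)
open import Data.Fin.Subset.Properties using (q⊆p∪q; x∈⁅x⁆)
open import Data.Vec using ([]; _∷_; here; there)
open import Data.Sum using (_⊎_; inj₁; inj₂)
open import Data.Product using (Σ-syntax; ∃-syntax; _×_; _,_)
open import Function.Bundles using (_↔_; Inverse)
open import Relation.Nullary using (¬_)
open import Relation.Unary using (Pred; _≐_)
open import Relation.Binary.PropositionalEquality using (_≡_; _≢_; refl; cong)
open import Algebra.Properties.CommutativeMonoid.Sum +-0-commutativeMonoid using (sum)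

private
  variable
    ℓ : Level
    n : ℕ

IsMinimum : Pred ℕ ℓ → ℕ → Set ℓ
IsMinimum A m = A m × (∀ {k} → A k → m ≤ k)

nth : (S : Subset n) → Fin ∣ S ∣ → Fin n
nth (inside  ∷ S) zero    = zero
nth (inside  ∷ S) (suc i) = suc (nth S i)
nth (outside ∷ S) i       = suc (nth S i)

position : (S : Subset n) {x : Fin n} → x ∈ S → Fin ∣ S ∣
position (inside  ∷ S) here      = zero
position (inside  ∷ S) (there p) = suc (position S p)
position (outside ∷ S) (there p) = position S p

nth-∈ : (S : Subset n) (i : Fin ∣ S ∣) → nth S i ∈ S
nth-∈ (inside  ∷ S) zero    = here
nth-∈ (inside  ∷ S) (suc i) = there (nth-∈ S i)
nth-∈ (outside ∷ S) i       = there (nth-∈ S i)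

nth-position : (S : Subset n) {x : Fin n} (p : x ∈ S) → nth S (position S p) ≡ x
nth-position (inside  ∷ S) here      = refl
nth-position (inside  ∷ S) (there p) = cong suc (nth-position S p)
nth-position (outside ∷ S) (there p) = cong suc (nth-position S p)

sumOver : Subset n → (Fin n → ℕ) → ℕ
sumOver S f = sum (λ i → f (nth S i))

-- Multigraphs are given by edge multiplicities: μ u v edges join u and v.
record Graph : Set where
  field
    order    : ℕ
    μ        : Fin order → Fin order → ℕ
    μ-sym    : ∀ u v → μ u v ≡ μ v u
    loopless : ∀ v → μ v v ≡ 0

open Graph public

Vertex : Graph → Set
Vertex G = Fin (order G)

deg : (G : Graph) → Vertex G → ℕ
deg G v = sum (μ G v)

IsMinDegree : Graph → ℕ → Set
IsMinDegree G = IsMinimum (λ k → ∃[ v ] deg G v ≡ k)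

record _≅_ (G H : Graph) : Set where
  field
    bijection   : Vertex G ↔ Vertex H
    preserves-μ : ∀ u v → μ H (Inverse.to bijection u) (Inverse.to bijection v) ≡ μ G u v

-- The induced subgraph on S; its i-th vertex is the i-th element of S.
_[_] : (G : Graph) → Subset (order G) → Graph
G [ S ] = record
  { order    = ∣ S ∣
  ; μ        = λ i j → μ G (nth S i) (nth S j)
  ; μ-sym    = λ i j → μ-sym G (nth S i) (nth S j)
  ; loopless = λ i → loopless G (nth S i)
  }

_without_ : (G : Graph) → Vertex G → Graph
G without v = G [ ⊤ - v ]

_⊍_ : Graph → Graph → Graph
G ⊍ H = record
  { order    = order G + order H
  ; μ        = λ u v → m (splitAt (order G) u) (splitAt (order G) v)
  ; μ-sym    = λ u v → m-sym (splitAt (order G) u) (splitAt (order G) v)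
  ; loopless = λ v → m-loopless (splitAt (order G) v)
  }
  where
  m : Vertex G ⊎ Vertex H → Vertex G ⊎ Vertex H → ℕ
  m (inj₁ u) (inj₁ v) = μ G u v
  m (inj₂ u) (inj₂ v) = μ H u v
  m (inj₁ _) (inj₂ _) = 0
  m (inj₂ _) (inj₁ _) = 0

  m-sym : ∀ s t → m s t ≡ m t s
  m-sym (inj₁ u) (inj₁ v) = μ-sym G u v
  m-sym (inj₂ u) (inj₂ v) = μ-sym H u v
  m-sym (inj₁ _) (inj₂ _) = refl
  m-sym (inj₂ _) (inj₁ _) = refl

  m-loopless : ∀ s → m s s ≡ 0
  m-loopless (inj₁ v) = loopless G v
  m-loopless (inj₂ v) = loopless H v

record GraphProperty ℓ : Set (lsuc ℓ) where
  field
    Holds     : Graph → Set ℓ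
    ≅-closed  : ∀ {G H} → G ≅ H → Holds G → Holds H

open GraphProperty public

module _ (P : GraphProperty ℓ) where

  NonTrivial : Set ℓ
  NonTrivial = (∃[ G ] order G > 0 × Holds P G) × ¬ (∀ G → Holds P G)

  Hereditary : Set ℓ
  Hereditary = ∀ G (S : Subset (order G)) → Holds P G → Holds P (G [ S ])

  Additive : Set ℓ
  Additive = ∀ G H → Holds P G → Holds P H → Holds P (G ⊍ H)

  record Reliable : Set ℓ where
    field
      nonTrivial : NonTrivial
      hereditary : Hereditary
      additive   : Additive

  CR : Pred Graph ℓ
  CR G = ¬ Holds P G × (∀ v → Holds P (G without v))

  -- Isd r means d(P) = r.
  Isd : ℕ → Set ℓ
  Isd = IsMinimum (λ k → ∃[ G ] CR G × IsMinDegree G k)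

-- An edge of H between A and B. For disjoint A and B every such edge has
-- exactly one representative: its end in A, its end in B, and its label among
-- the parallel edges joining them.
record EdgeBetween (H : Graph) (A B : Subset (order H)) : Set where
  constructor edge
  field
    endA   : Vertex H
    endB   : Vertex H
    .endA∈ : endA ∈ A
    .endB∈ : endB ∈ B
    label  : Fin (μ H endA endB)

open EdgeBetween public

module _ {H : Graph} {A B : Subset (order H)} where

  _IsEndOf_ : Vertex H → EdgeBetween H A B → Set
  x IsEndOf e = x ≡ endA e ⊎ x ≡ endB e

  IsMatching : Pred (EdgeBetween H A B) 0ℓ → Set
  IsMatching M = ∀ {e f x} → M e → M f → x IsEndOf e → x IsEndOf f → e ≡ f

IsUnionOfMatchings : (H : Graph) (A B : Subset (order H)) → ℕ → Set₁
IsUnionOfMatchings H A B k =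
  Σ[ M ∈ (Fin k → Pred (EdgeBetween H A B) 0ℓ) ]
    (∀ i → IsMatching (M i)) × (∀ e → ∃[ i ] M i e)

record Cover (G : Graph) : Set₁ where
  field
    H           : Graph
    X           : Vertex G → Subset (order H)
    disjoint    : ∀ {u v} → u ≢ v → Empty (X u ∩ X v)
    exhaustive  : ∀ x → ∃[ v ] x ∈ X v
    independent : ∀ v {x y} → x ∈ X v → y ∈ X v → μ H x y ≡ 0
    matchings   : ∀ {u v} → u ≢ v → IsUnionOfMatchings H (X u) (X v) (μ G u v)

module _ {G : Graph} (C : Cover G) where
  open Cover C

  IsTransversal : Subset (order H) → Set
  IsTransversal T = ∀ v → ∣ T ∩ X v ∣ ≡ 1

  IsPartialTransversal : Subset (order H) → Set
  IsPartialTransversal T = ∀ v → ∣ T ∩ X v ∣ ≤ 1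

  dom : Subset (order H) → Pred (Vertex G) 0ℓ
  dom T v = Nonempty (X v ∩ T)

  degIn : Subset (order H) → Vertex H → ℕ
  degIn T x = deg (H [ T ∪ ⁅ x ⁆ ]) (position (T ∪ ⁅ x ⁆) (q⊆p∪q T ⁅ x ⁆ (x∈⁅x⁆ x)))

  module _ (P : GraphProperty ℓ) where

    IsPTransversal : Subset (order H) → Set ℓ
    IsPTransversal T = IsTransversal T × Holds P (H [ T ])

    IsPvTransversal : Vertex G → Subset (order H) → Set ℓ
    IsPvTransversal v T =
      IsPartialTransversal T × dom T ≐ (_∈ ⊤ - v) × Holds P (H [ T ])

    IsCritical : Set ℓ
    IsCritical = ¬ (∃[ T ] IsPTransversal T) × (∀ v → ∃[ T ] IsPvTransversal v T)

{-# OPTIONS --safe #-}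

-- Adding x ∈ X v to a (P,v)-transversal T gives a transversal, so H[T ∪ {x}] is
-- not in P. It therefore contains a P-critical induced subgraph, which must use x
-- because H[T] is in P; hence x has degree at least r in H[T ∪ {x}]. On the other
-- hand, each y ∈ T lies in some X u with u ≢ v, and since a matching has at most
-- one edge at y, at most μ G v u edges join y to X v. Summing over y ∈ T bounds the
-- total degree of the x ∈ X v by deg G v.
module Submission where

open import Defs
open import Level using (Level)
open import Data.Nat using (ℕ; zero; suc; _+_; _*_; _≤_; _<_; _≥_; _≤?_; z≤n; s≤s)
open import Data.Nat.Properties
  using ( ≤-reflexive; ≤-trans; ≤-antisym; +-mono-≤; +-monoˡ-≤; +-monoʳ-≤; +-cancelˡ-≤
        ; +-cancelʳ-≤; +-identityʳ; +-assoc; *-comm; m≤n+m; module ≤-Reasoning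
        ; +-0-commutativeMonoid)
open import Data.Nat.Induction using (<-wellFounded)
open import Data.Nat.Tactic.RingSolver using (solve-∀)
open import Induction.WellFounded using (Acc; acc)
open import Data.Fin using (Fin; zero; suc; splitAt; _↑ˡ_; _↑ʳ_; punchOut; punchIn)
open import Data.Fin.Properties
  using ( _≟_; any?; suc-injective; splitAt⁻¹-↑ˡ; splitAt⁻¹-↑ʳ; punchOut-injective
        ; punchIn-punchOut; injective⇒≤; sequence)
open import Data.Fin.Subset
  using (Subset; inside; outside; ⊤; ⁅_⁆; _∈_; _∉_; _∩_; _∪_; _-_; ∣_∣)
open import Data.Fin.Subset.Properties
  using ( ∈⊤; x∈⁅x⁆; x∈⁅y⁆⇒x≡y; ∣⁅x⁆∣≡1; ∣⊤∣≡n; ⊆-antisym; x∈p∧x≢y⇒x∈p-y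
        ; x∈p⇒∣p-x∣<∣p∣; x∈p∩q⁺; x∈p∩q⁻; x∈p∪q⁻; p⊆p∪q; q⊆p∪q)
open import Data.Vec using ([]; _∷_; there; tabulate)
open import Data.Vec.Properties using (lookup⇒[]=; []=⇒lookup; lookup∘tabulate)
open import Data.List using (allFin)
open import Data.List.Extrema.Nat using (argmin; f[argmin]≤f[xs])
open import Data.List.Membership.Propositional.Properties using (∈-allFin)
import Data.List.Relation.Unary.All as All
open import Data.Product using (Σ; ∃-syntax; _×_; _,_; proj₁; proj₂)
open import Data.Sum using (inj₁; inj₂)
open import Effect.Monad using (RawMonad)
open import Function using (_∘_; Injective; mk↔ₛ′)
open import Relation.Nullary using (¬_; yes; no; does; contradiction)
open import Relation.Nullary.Decidable using (decidable-stable; dec-true)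
open import Relation.Nullary.Negation using (¬¬-Monad)
open import Relation.Binary.PropositionalEquality
  using (_≡_; _≢_; refl; sym; trans; cong; cong₂; subst)
open import Algebra.Properties.CommutativeMonoid.Sum +-0-commutativeMonoid
  using (sum; sum-remove; sum-replicate-zero; sum-cong-≗; ∑-comm)

private
  variable
    ℓ : Level
    k m n : ℕ

sum-mono : {f g : Fin n → ℕ} → (∀ i → f i ≤ g i) → sum f ≤ sum g
sum-mono {zero}  f≤g = z≤n
sum-mono {suc n} f≤g = +-mono-≤ (f≤g zero) (sum-mono (f≤g ∘ suc))

sum-mono-tight : {f g : Fin n → ℕ} → (∀ i → f i ≤ g i) → sum g ≤ sum f → ∀ i → g i ≡ f i
sum-mono-tight {suc n} {f} {g} f≤g Σg≤Σf zero = ≤-antisym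
  (+-cancelʳ-≤ (sum (g ∘ suc)) (g zero) (f zero)
    (≤-trans Σg≤Σf (+-monoʳ-≤ (f zero) (sum-mono (f≤g ∘ suc)))))
  (f≤g zero)
sum-mono-tight {suc n} {f} {g} f≤g Σg≤Σf (suc i) = sum-mono-tight (f≤g ∘ suc)
  (+-cancelˡ-≤ (g zero) (sum (g ∘ suc)) (sum (f ∘ suc))
    (≤-trans Σg≤Σf (+-monoˡ-≤ (sum (f ∘ suc)) (f≤g zero)))) i

sum-const : ∀ n {c} → sum {n} (λ _ → c) ≡ n * c
sum-const zero    = refl
sum-const (suc n) = cong (_ +_) (sum-const n)

sum-∘-injective : {g : Fin m → Fin n} → Injective _≡_ _≡_ g → ∀ f → sum (f ∘ g) ≤ sum f
sum-∘-injective {zero}          _   f = z≤n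
sum-∘-injective {suc m} {zero}  {g} _ f = contradiction (g zero) λ ()
sum-∘-injective {suc m} {suc n} {g} inj f = begin
  f (g zero) + sum (f ∘ g ∘ suc)
    ≡⟨ cong (f (g zero) +_) (sum-cong-≗ λ i → cong f (punchIn-punchOut (g₀≢ i))) ⟨
  f (g zero) + sum (f ∘ punchIn (g zero) ∘ g′)
    ≤⟨ +-monoʳ-≤ (f (g zero)) (sum-∘-injective g′-injective (f ∘ punchIn (g zero))) ⟩
  f (g zero) + sum (f ∘ punchIn (g zero))
    ≡⟨ sum-remove f ⟨
  sum f ∎
  where
  open ≤-Reasoning
  g₀≢ : ∀ i → g zero ≢ g (suc i)
  g₀≢ i eq with () ← inj eq
  g′ : Fin m → Fin n
  g′ i = punchOut (g₀≢ i)
  g′-injective : Injective _≡_ _≡_ g′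
  g′-injective {i} {j} eq = suc-injective (inj (punchOut-injective (g₀≢ i) (g₀≢ j) eq))

unflatten : (m : Fin n → ℕ) → Fin (sum m) → Σ (Fin n) (Fin ∘ m)
unflatten {suc n} m i with splitAt (m zero) i
... | inj₁ j = zero , j
... | inj₂ j with unflatten (m ∘ suc) j
...   | a , l = suc a , l

flatten : (m : Fin n → ℕ) → Σ (Fin n) (Fin ∘ m) → Fin (sum m)
flatten {suc n} m (zero  , i) = i ↑ˡ _
flatten {suc n} m (suc a , i) = m zero ↑ʳ flatten (m ∘ suc) (a , i)

flatten-unflatten : (m : Fin n → ℕ) → ∀ i → flatten m (unflatten m i) ≡ i
flatten-unflatten {suc n} m i with splitAt (m zero) i in eq
... | inj₁ j = splitAt⁻¹-↑ˡ eq
... | inj₂ j = trans (cong (m zero ↑ʳ_) (flatten-unflatten (m ∘ suc) j)) (splitAt⁻¹-↑ʳ eq)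

Σ-injective⇒≤ : (m : Fin n → ℕ) {f : Σ (Fin n) (Fin ∘ m) → Fin k} →
                Injective _≡_ _≡_ f → sum m ≤ k
Σ-injective⇒≤ m {f} inj = injective⇒≤ {f = f ∘ unflatten m} λ {i} {j} eq →
  trans (sym (flatten-unflatten m i)) (trans (cong (flatten m) (inj eq)) (flatten-unflatten m j))

nth-injective : (S : Subset n) → Injective _≡_ _≡_ (nth S)
nth-injective (inside  ∷ S) {zero}  {zero}  _  = refl
nth-injective (inside  ∷ S) {suc i} {suc j} eq = cong suc (nth-injective S (suc-injective eq))
nth-injective (outside ∷ S) eq                 = nth-injective S (suc-injective eq)

sumOver-∪ : (p q : Subset n) (f : Fin n → ℕ) → sumOver (p ∪ q) f ≤ sumOver p f + sumOver q f
sumOver-∪ []            []            f = z≤n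
sumOver-∪ (outside ∷ p) (outside ∷ q) f = sumOver-∪ p q (f ∘ suc)
sumOver-∪ (inside  ∷ p) (outside ∷ q) f = begin
  f zero + sumOver (p ∪ q) (f ∘ suc)        ≤⟨ +-monoʳ-≤ (f zero) (sumOver-∪ p q (f ∘ suc)) ⟩
  f zero + (sumOver p (f ∘ suc) + sumOver q (f ∘ suc))
    ≡⟨ +-assoc (f zero) (sumOver p (f ∘ suc)) (sumOver q (f ∘ suc)) ⟨
  f zero + sumOver p (f ∘ suc) + sumOver q (f ∘ suc) ∎
  where open ≤-Reasoning
sumOver-∪ (outside ∷ p) (inside  ∷ q) f = begin
  f zero + sumOver (p ∪ q) (f ∘ suc)        ≤⟨ +-monoʳ-≤ (f zero) (sumOver-∪ p q (f ∘ suc)) ⟩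
  f zero + (sumOver p (f ∘ suc) + sumOver q (f ∘ suc))
    ≡⟨ swap (f zero) (sumOver p (f ∘ suc)) (sumOver q (f ∘ suc)) ⟩
  sumOver p (f ∘ suc) + (f zero + sumOver q (f ∘ suc)) ∎
  where
  open ≤-Reasoning
  swap : ∀ a b c → a + (b + c) ≡ b + (a + c)
  swap = solve-∀
sumOver-∪ (inside  ∷ p) (inside  ∷ q) f = begin
  f zero + sumOver (p ∪ q) (f ∘ suc)        ≤⟨ +-monoʳ-≤ (f zero) (sumOver-∪ p q (f ∘ suc)) ⟩
  f zero + (sumOver p (f ∘ suc) + sumOver q (f ∘ suc))
    ≤⟨ m≤n+m _ (f zero) ⟩
  f zero + (f zero + (sumOver p (f ∘ suc) + sumOver q (f ∘ suc)))
    ≡⟨ swap (f zero) (sumOver p (f ∘ suc)) (sumOver q (f ∘ suc)) ⟩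
  f zero + sumOver p (f ∘ suc) + (f zero + sumOver q (f ∘ suc)) ∎
  where
  open ≤-Reasoning
  swap : ∀ a b c → a + (a + (b + c)) ≡ a + b + (a + c)
  swap = solve-∀

sumOver-vanishing : (S : Subset n) (f : Fin n → ℕ) → (∀ {x} → x ∈ S → f x ≡ 0) → sumOver S f ≡ 0
sumOver-vanishing S f f≡0 =
  trans (sum-cong-≗ (λ i → f≡0 (nth-∈ S i))) (sum-replicate-zero ∣ S ∣)

Fin-≤1-irrelevant : n ≤ 1 → (i j : Fin n) → i ≡ j
Fin-≤1-irrelevant (s≤s z≤n) zero zero = refl

∣p∣≤1⇒≡ : (S : Subset n) → ∣ S ∣ ≤ 1 → ∀ {x y} → x ∈ S → y ∈ S → x ≡ y
∣p∣≤1⇒≡ S ∣S∣≤1 x∈S y∈S = trans (sym (nth-position S x∈S))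
  (trans (cong (nth S) (Fin-≤1-irrelevant ∣S∣≤1 _ _)) (nth-position S y∈S))

unique⇒∣p∣≡1 : (S : Subset n) {x : Fin n} → x ∈ S → (∀ {y} → y ∈ S → y ≡ x) → ∣ S ∣ ≡ 1
unique⇒∣p∣≡1 S {x} x∈S unique = trans (cong ∣_∣ S≡⁅x⁆) (∣⁅x⁆∣≡1 x)
  where
  S≡⁅x⁆ : S ≡ ⁅ x ⁆
  S≡⁅x⁆ = ⊆-antisym (λ y∈S → subst (_∈ ⁅ x ⁆) (sym (unique y∈S)) (x∈⁅x⁆ x))
                    (λ y∈⁅x⁆ → subst (_∈ S) (sym (x∈⁅y⁆⇒x≡y x y∈⁅x⁆)) x∈S)

image : (Fin m → Fin n) → Subset n
image f = tabulate λ y → does (any? λ i → f i ≟ y)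

∈-image⁺ : (f : Fin m → Fin n) → ∀ i → f i ∈ image f
∈-image⁺ f i = lookup⇒[]= (f i) (image f)
  (trans (lookup∘tabulate _ (f i)) (dec-true (any? λ j → f j ≟ f i) (i , refl)))

∈-image⁻ : (f : Fin m → Fin n) → ∀ {y} → y ∈ image f → ∃[ i ] f i ≡ y
∈-image⁻ f {y} y∈ with any? (λ i → f i ≟ y) | trans (sym (lookup∘tabulate _ y)) ([]=⇒lookup y∈)
... | yes found | _ = found
... | no _      | ()

x∉p-x : (p : Subset n) (x : Fin n) → x ∉ p - x
x∉p-x (inside  ∷ p) zero    ()
x∉p-x (outside ∷ p) zero    ()
x∉p-x (_       ∷ p) (suc x) (there x∈) = x∉p-x p x x∈

without-order : ∀ K (v : Vertex K) → order (K without v) < order K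
without-order K v = subst (∣ ⊤ - v ∣ <_) (∣⊤∣≡n (order K)) (x∈p⇒∣p-x∣<∣p∣ {p = ⊤} (∈⊤ {x = v}))

without-≢ : ∀ K (v : Vertex K) (i : Vertex (K without v)) → nth (⊤ - v) i ≢ v
without-≢ K v i eq = x∉p-x ⊤ v (subst (_∈ ⊤ - v) eq (nth-∈ (⊤ - v) i))

deg-without : ∀ K (v : Vertex K) {x} (x∈ : x ∈ ⊤ - v) →
              deg (K without v) (position (⊤ - v) x∈) ≤ deg K x
deg-without K v x∈ rewrite nth-position (⊤ - v) x∈ =
  sum-∘-injective (nth-injective (⊤ - v)) (μ K _)

minDegree-vertex : ∀ K → Vertex K → ∃[ v ] (∀ u → deg K v ≤ deg K u)
minDegree-vertex K x = argmin (deg K) x (allFin (order K)) ,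
  λ u → All.lookup (f[argmin]≤f[xs] x (allFin (order K))) (∈-allFin u)

module _ (P : GraphProperty ℓ) (hereditary : Hereditary P) where

  Holds-embedding : ∀ K L (f : Vertex K → Vertex L) → Injective _≡_ _≡_ f →
                    (∀ i j → μ L (f i) (f j) ≡ μ K i j) → Holds P L → Holds P K
  Holds-embedding K L f inj preserves PL = ≅-closed P L[image]≅K (hereditary L S PL)
    where
    S = image f
    pre : ∀ j → ∃[ i ] f i ≡ nth S j
    pre j = ∈-image⁻ f (nth-∈ S j)
    to : Vertex (L [ S ]) → Vertex K
    to j = proj₁ (pre j)
    from : Vertex K → Vertex (L [ S ])
    from i = position S (∈-image⁺ f i)
    L[image]≅K : (L [ S ]) ≅ K
    L[image]≅K = record
      { bijection = mk↔ₛ′ to from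
          (λ i → inj (trans (proj₂ (pre (from i))) (nth-position S (∈-image⁺ f i))))
          (λ j → nth-injective S (trans (nth-position S (∈-image⁺ f (to j))) (proj₂ (pre j))))
      ; preserves-μ = λ i j →
          trans (sym (preserves (to i) (to j))) (cong₂ (μ L) (proj₂ (pre i)) (proj₂ (pre j)))
      }

  Holds-embedding-into : ∀ K L (S : Subset (order L)) (f : Vertex K → Vertex L) →
                         Injective _≡_ _≡_ f → (∀ i j → μ L (f i) (f j) ≡ μ K i j) →
                         (∀ i → f i ∈ S) → Holds P (L [ S ]) → Holds P K
  Holds-embedding-into K L S f inj preserves f∈S = Holds-embedding K (L [ S ]) f′ inj′
    λ i j → trans (cong₂ (μ L) (f′-≡ i) (f′-≡ j)) (preserves i j)
    where
    f′ : Vertex K → Vertex (L [ S ])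
    f′ i = position S (f∈S i)
    f′-≡ : ∀ i → nth S (f′ i) ≡ f i
    f′-≡ i = nth-position S (f∈S i)
    inj′ : Injective _≡_ _≡_ f′
    inj′ {i} {j} eq = inj (trans (sym (f′-≡ i)) (trans (cong (nth S) eq) (f′-≡ j)))

  CR⇒≤deg : ∀ {r} → Isd P r → ∀ K → CR P K → ∀ x → r ≤ deg K x
  CR⇒≤deg (_ , lower) K crit x with v , least ← minDegree-vertex K x =
    ≤-trans (lower (K , crit , (v , refl) , λ { (u , refl) → least u })) (least x)

  -- P need not be decidable, so whether K is P-critical is only decided up to double
  -- negation; the conclusion, being decidable, absorbs it.
  ≤deg-of-essential : ∀ {r} → Isd P r → ∀ K → Acc _<_ (order K) → (x : Vertex K) →
                      ¬ Holds P K → Holds P (K without x) → r ≤ deg K x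
  ≤deg-of-essential {r} isd K (acc rec) x ¬PK PK-x = decidable-stable (r ≤? deg K x) λ r≰ →
    sequence (RawMonad.rawApplicative ¬¬-Monad) (¬¬PK-v r≰)
      λ all → r≰ (CR⇒≤deg isd K (¬PK , all) x)
    where
    ¬¬PK-v : ¬ (r ≤ deg K x) → ∀ v → ¬ ¬ Holds P (K without v)
    ¬¬PK-v r≰ v ¬PK-v with v ≟ x
    ... | yes refl = ¬PK-v PK-x
    ... | no v≢x   = r≰ (≤-trans
      (≤deg-of-essential isd (K without v) (rec (without-order K v)) x′ ¬PK-v P[K-v-x′])
      (deg-without K v x∈))
      where
      x∈ : x ∈ ⊤ - v
      x∈ = x∈p∧x≢y⇒x∈p-y ∈⊤ (v≢x ∘ sym)
      x′ : Vertex (K without v)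
      x′ = position (⊤ - v) x∈
      f : Vertex ((K without v) without x′) → Vertex K
      f i = nth (⊤ - v) (nth (⊤ - x′) i)
      f≢x : ∀ i → f i ≢ x
      f≢x i eq = without-≢ (K without v) x′ i
        (nth-injective (⊤ - v) (trans eq (sym (nth-position (⊤ - v) x∈))))
      P[K-v-x′] : Holds P ((K without v) without x′)
      P[K-v-x′] = Holds-embedding-into _ K (⊤ - x) f
        (nth-injective (⊤ - x′) ∘ nth-injective (⊤ - v)) (λ _ _ → refl)
        (λ i → x∈p∧x≢y⇒x∈p-y ∈⊤ (f≢x i)) PK-x

matchings-bound : (H : Graph) {A B : Subset (order H)} → IsUnionOfMatchings H A B k →
                  ∀ {y} → y ∈ B → sumOver A (λ x → μ H x y) ≤ k
matchings-bound {k} H {A} {B} (M , matching , covers) {y} y∈B =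
  Σ-injective⇒≤ _ {f = λ e → proj₁ (covers (toEdge e))} injective
  where
  Edges = Σ (Fin ∣ A ∣) λ i → Fin (μ H (nth A i) y)
  toEdge : Edges → EdgeBetween H A B
  toEdge (i , l) = edge (nth A i) y (nth-∈ A i) y∈B l
  edge-label : ∀ {i} {l l′ : Fin (μ H (nth A i) y)} → toEdge (i , l) ≡ toEdge (i , l′) → l ≡ l′
  edge-label refl = refl
  toEdge-injective : Injective _≡_ _≡_ toEdge
  toEdge-injective {i , l} {j , l′} eq with nth-injective A (cong endA eq)
  ... | refl = cong (i ,_) (edge-label eq)
  injective : Injective _≡_ _≡_ (λ e → proj₁ (covers (toEdge e)))
  injective {e} {e′} eq = toEdge-injective (matching _
    (proj₂ (covers (toEdge e)))
    (subst (λ c → M c (toEdge e′)) (sym eq) (proj₂ (covers (toEdge e′))))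
    (inj₂ refl) (inj₂ refl))

module _ {G : Graph} (C : Cover G) where
  open Cover C

  degIn-≤ : ∀ T x → degIn C T x ≤ sumOver T (μ H x)
  degIn-≤ T x rewrite nth-position (T ∪ ⁅ x ⁆) (q⊆p∪q T ⁅ x ⁆ (x∈⁅x⁆ x)) = begin
    sumOver (T ∪ ⁅ x ⁆) (μ H x)                ≤⟨ sumOver-∪ T ⁅ x ⁆ (μ H x) ⟩
    sumOver T (μ H x) + sumOver ⁅ x ⁆ (μ H x)
      ≡⟨ cong (sumOver T (μ H x) +_) (sumOver-vanishing ⁅ x ⁆ (μ H x) at-x) ⟩
    sumOver T (μ H x) + 0                      ≡⟨ +-identityʳ _ ⟩
    sumOver T (μ H x)                          ∎
    where
    open ≤-Reasoning
    at-x : ∀ {y} → y ∈ ⁅ x ⁆ → μ H x y ≡ 0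
    at-x y∈ rewrite x∈⁅y⁆⇒x≡y x y∈ = loopless H x

  part : Vertex H → Vertex G
  part y = proj₁ (exhaustive y)

  part-injective : ∀ {T} → IsPartialTransversal C T → ∀ {y z} → y ∈ T → z ∈ T →
                   part y ≡ part z → y ≡ z
  part-injective {T} partial {y} {z} y∈T z∈T eq = ∣p∣≤1⇒≡ (T ∩ X (part z)) (partial (part z))
    (x∈p∩q⁺ (y∈T , subst (λ u → y ∈ X u) eq (proj₂ (exhaustive y))))
    (x∈p∩q⁺ (z∈T , proj₂ (exhaustive z)))

  sum-degIn-≤ : ∀ {T v} → IsPartialTransversal C T → ¬ dom C T v →
                sumOver (X v) (degIn C T) ≤ deg G v
  sum-degIn-≤ {T} {v} partial v∉dom = begin
    sumOver (X v) (degIn C T)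
      ≤⟨ sum-mono (λ i → degIn-≤ T (nth (X v) i)) ⟩
    sumOver (X v) (λ x → sumOver T (μ H x))
      ≡⟨ ∑-comm (λ i j → μ H (nth (X v) i) (nth T j)) ⟩
    sumOver T (λ y → sumOver (X v) (λ x → μ H x y))
      ≤⟨ sum-mono (λ j → matchings-bound H (matchings (v≢part (nth-∈ T j)))
                           (proj₂ (exhaustive (nth T j)))) ⟩
    sumOver T (μ G v ∘ part)
      ≤⟨ sum-∘-injective (λ {i} {j} eq → nth-injective T
           (part-injective partial (nth-∈ T i) (nth-∈ T j) eq)) (μ G v) ⟩
    deg G v ∎
    where
    open ≤-Reasoning
    v≢part : ∀ {y} → y ∈ T → v ≢ part y
    v≢part {y} y∈T refl = v∉dom (y , x∈p∩q⁺ (proj₂ (exhaustive y) , y∈T))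

  ∪-isTransversal : ∀ {T v x} → IsPartialTransversal C T → ¬ dom C T v →
                    (∀ {u} → u ≢ v → dom C T u) → x ∈ X v → IsTransversal C (T ∪ ⁅ x ⁆)
  ∪-isTransversal {T} {v} {x} partial v∉dom rest x∈Xv u with u ≟ v
  ... | yes refl = unique⇒∣p∣≡1 _ (x∈p∩q⁺ (q⊆p∪q T ⁅ x ⁆ (x∈⁅x⁆ x) , x∈Xv)) unique
    where
    unique : ∀ {y} → y ∈ (T ∪ ⁅ x ⁆) ∩ X v → y ≡ x
    unique {y} y∈ with x∈p∩q⁻ (T ∪ ⁅ x ⁆) (X v) y∈
    ... | y∈S , y∈Xv with x∈p∪q⁻ T ⁅ x ⁆ y∈S
    ...   | inj₁ y∈T = contradiction (y , x∈p∩q⁺ (y∈Xv , y∈T)) v∉dom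
    ...   | inj₂ y∈x = x∈⁅y⁆⇒x≡y x y∈x
  ... | no u≢v with rest u≢v
  ...   | y , y∈ with x∈p∩q⁻ (X u) T y∈
  ...     | y∈Xu , y∈T = unique⇒∣p∣≡1 _ (x∈p∩q⁺ (p⊆p∪q ⁅ x ⁆ y∈T , y∈Xu)) unique
    where
    unique : ∀ {z} → z ∈ (T ∪ ⁅ x ⁆) ∩ X u → z ≡ y
    unique {z} z∈ with x∈p∩q⁻ (T ∪ ⁅ x ⁆) (X u) z∈
    ... | z∈S , z∈Xu with x∈p∪q⁻ T ⁅ x ⁆ z∈S
    ...   | inj₁ z∈T = ∣p∣≤1⇒≡ (T ∩ X u) (partial u) (x∈p∩q⁺ (z∈T , z∈Xu)) (x∈p∩q⁺ (y∈T , y∈Xu))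
    ...   | inj₂ z∈x rewrite x∈⁅y⁆⇒x≡y x z∈x =
      contradiction (x , x∈p∩q⁺ (z∈Xu , x∈Xv)) (disjoint u≢v)

  module _ (P : GraphProperty ℓ) {r : ℕ} (reliable : Reliable P) (isd : Isd P r)
           (noTransversal : ¬ (∃[ T ] IsPTransversal C P T)) where
    open Reliable reliable

    ≤degIn : ∀ {v T} → IsPvTransversal C P v T → ∀ {x} → x ∈ X v → r ≤ degIn C T x
    ≤degIn {v} {T} (partial , (dom⊆ , dom⊇) , PT) {x} x∈Xv =
      ≤deg-of-essential P hereditary isd (H [ S ]) (<-wellFounded _) p
        (λ PS → noTransversal (S , ∪-isTransversal partial (x∉p-x ⊤ v ∘ dom⊆)
                                     (λ u≢v → dom⊇ (x∈p∧x≢y⇒x∈p-y ∈⊤ u≢v)) x∈Xv , PS))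
        (Holds-embedding-into P hereditary _ H T (nth S ∘ nth (⊤ - p))
          (nth-injective (⊤ - p) ∘ nth-injective S) (λ _ _ → refl) in-T PT)
      where
      S = T ∪ ⁅ x ⁆
      x∈S : x ∈ S
      x∈S = q⊆p∪q T ⁅ x ⁆ (x∈⁅x⁆ x)
      p : Vertex (H [ S ])
      p = position S x∈S
      in-T : ∀ i → nth S (nth (⊤ - p) i) ∈ T
      in-T i with x∈p∪q⁻ T ⁅ x ⁆ (nth-∈ S (nth (⊤ - p) i))
      ... | inj₁ ∈T = ∈T
      ... | inj₂ ∈x = contradiction
        (nth-injective S (trans (x∈⁅y⁆⇒x≡y x ∈x) (sym (nth-position S x∈S))))
        (without-≢ (H [ S ]) p i)

    module _ {v T} (pv : IsPvTransversal C P v T) where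

      r∣Xv∣≡sum : r * ∣ X v ∣ ≡ sumOver (X v) (λ _ → r)
      r∣Xv∣≡sum = trans (*-comm r ∣ X v ∣) (sym (sum-const ∣ X v ∣))

      r∣Xv∣≤sum-degIn : r * ∣ X v ∣ ≤ sumOver (X v) (degIn C T)
      r∣Xv∣≤sum-degIn = subst (_≤ sumOver (X v) (degIn C T)) (sym r∣Xv∣≡sum)
        (sum-mono (λ i → ≤degIn pv (nth-∈ (X v) i)))

      sum-degIn≤deg : sumOver (X v) (degIn C T) ≤ deg G v
      sum-degIn≤deg = sum-degIn-≤ (proj₁ pv) (x∉p-x ⊤ v ∘ proj₁ (proj₁ (proj₂ pv)))

      degIn≡r : deg G v ≡ r * ∣ X v ∣ → ∀ x → x ∈ X v → degIn C T x ≡ r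
      degIn≡r eq x x∈Xv = subst (λ y → degIn C T y ≡ r) (nth-position (X v) x∈Xv)
        (sum-mono-tight (λ i → ≤degIn pv (nth-∈ (X v) i))
          (≤-trans sum-degIn≤deg (≤-reflexive (trans eq r∣Xv∣≡sum))) (position (X v) x∈Xv))

proposition3 : ∀ {ℓ} (P : GraphProperty ℓ) (r : ℕ) → Reliable P → Isd P r →
    (G : Graph) (C : Cover G) → IsCritical C P →
    let open Cover C in
    (∀ v → deg G v ≥ r * ∣ X v ∣)
    × (∀ v → deg G v ≡ r * ∣ X v ∣ →
    ∀ T → IsPvTransversal C P v T →
    (∀ x → x ∈ X v → degIn C T x ≡ r)
    × deg G v ≡ sumOver (X v) (degIn C T))
proposition3 P r reliable isd G C (noTransversal , near) =
  (λ v → ≤-trans (r∣Xv∣≤sum-degIn C P reliable isd noTransversal (proj₂ (near v)))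
                 (sum-degIn≤deg C P reliable isd noTransversal (proj₂ (near v)))) ,
  λ v eq T pv →
    degIn≡r C P reliable isd noTransversal pv eq ,
    ≤-antisym (≤-trans (≤-reflexive eq) (r∣Xv∣≤sum-degIn C P reliable isd noTransversal pv))
              (sum-degIn≤deg C P reliable isd noTransversal pv)
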